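{- Let $G$ be a finite simple graph with diameter $2$. Then $G$ is $\chi_\rho$-critical if and only if for each edge $e=u_1u_2 \in E(G)$ at least one of the following statements holds: (i) $\alpha(G-e)>\alpha(G)$; (ii) there exist indices $\{i,j\}=\{1,2\}$, a vertex $y \in N_G[u_i]$ with $d_{G-e}(y,u_j) \geq 3$, and a maximum independent set $A$ of $G$ (i.e., $|A|=\alpha(G)$) such that $A \cap \{y, u_j\}= \emptyset$.
   Context: $N_G[v]=N_G(v)\cup\{v\}$ is the closed neighborhood; $\alpha(G)$ is the independence number. A $k$-packing coloring of $G$ is a map $c:V(G)\to\{1,\ldots,k\}$ such that two distinct vertices $u,v$ with $c(u)=c(v)=i$ satisfy $d_G(u,v)>i$ (distance between vertices in different components is infinite); $\chi_\rho(G)$ is the smallest $k$ for which such a coloring exists. $G$ is $\chi_\rho$-critical if $\chi_\rho(H)<\chi_\rho(G)$ for every proper subgraph $H$ of $G$. $G-e$ is $G$ with edge $e$ deleted. -}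

module Defs where

open import Data.Nat using (ℕ; zero; suc; _+_; _∸_; _≤_; _<_; z≤n; s≤s; s≤s⁻¹; _≤?_)
import Data.Nat.Properties as ℕ
open import Data.Nat.Induction using (<-rec)
open import Data.Fin using (Fin; zero; suc; toℕ; fromℕ<)
import Data.Fin.Properties as Fin
open import Data.Fin.Subset using (Subset; _∈_; _⊆_; ∣_∣; ⊥)
open import Data.Fin.Subset.Properties using (_∈?_; _⊆?_; anySubset?; ∣p∣≤n; ∣⊥∣≡0; ⊥⊆; ∉⊥)
open import Data.Vec using (Vec; []; _∷_; lookup; tabulate)
open import Data.Vec.Properties using (lookup∘tabulate)
open import Data.Product using (∃; ∃₂; _×_; _,_; proj₁; proj₂)
open import Data.Sum using (_⊎_; inj₁; inj₂)
open import Function using (_∘_)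
open import Level using (0ℓ)
open import Relation.Binary using (Rel; Symmetric; Irreflexive; Decidable)
open import Relation.Binary.PropositionalEquality using (_≡_; _≢_; refl; sym; trans; cong; subst)
import Relation.Binary.Construct.Add.Supremum.Strict as Strict
import Relation.Binary.Construct.Add.Supremum.NonStrict as NonStrict
open import Relation.Nullary using (¬_; Dec; yes; no; contradiction)
open import Relation.Nullary.Construct.Add.Supremum using (_⁺; ⊤⁺; [_])
open import Relation.Nullary.Decidable using (map′; _×-dec_; _→-dec_; _⊎-dec_; ¬?)
import Relation.Unary as U

ℕ∞ : Set
ℕ∞ = ℕ ⁺

open Strict _<_ public using () renaming (_<⁺_ to _<∞_; <⁺-dec to <∞-dec)
open NonStrict _≤_ public using () renaming (_≤⁺_ to _≤∞_)

IsLeast : (ℕ → Set) → ℕ → Set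
IsLeast P k = P k × (∀ j → P j → k ≤ j)

IsGreatest : (ℕ → Set) → ℕ → Set
IsGreatest P k = P k × (∀ j → P j → j ≤ k)

least : ∀ {P : ℕ → Set} → U.Decidable P → ∀ b → P b → ∃ (IsLeast P)
least P? zero pb = zero , pb , λ _ _ → z≤n
least {P} P? (suc b) pb with P? zero
... | yes p0 = zero , p0 , λ _ _ → z≤n
... | no ¬p0 with least {P ∘ suc} (P? ∘ suc) b pb
...   | k , pk , min = suc k , pk , λ where
          zero    p0 → contradiction p0 ¬p0
          (suc j) pj → s≤s (min j pj)

greatest : ∀ {P : ℕ → Set} → U.Decidable P → P 0 → ∀ b → (∀ j → P j → j ≤ b) → ∃ (IsGreatest P)
greatest P? p0 zero bound = zero , p0 , bound
greatest {P} P? p0 (suc b) bound with P? (suc b)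
... | yes pb = suc b , pb , bound
... | no ¬pb = greatest P? p0 b λ j pj →
        s≤s⁻¹ (ℕ.≤∧≢⇒< (bound j pj) λ j≡ → ¬pb (subst P j≡ pj))

-- A finite simple graph whose vertex set V is any subset of the ambient
-- set Fin n, so that a subgraph lives over the same ambient set.
record Graph (n : ℕ) : Set₁ where
  field
    V        : Subset n
    Adj      : Rel (Fin n) 0ℓ
    Adj⇒∈V   : ∀ {u v} → Adj u v → u ∈ V × v ∈ V
    symm     : Symmetric Adj
    irrefl   : Irreflexive _≡_ Adj
    _adj?_   : Decidable Adj

open Graph public

module _ {n : ℕ} where

  _⊑_ : Rel (Graph n) 0ℓ
  H ⊑ G = V H ⊆ V G × (∀ {u v} → Adj H u v → Adj G u v)

  ProperSubgraph : Rel (Graph n) 0ℓ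
  ProperSubgraph H G = H ⊑ G × ¬ (G ⊑ H)

  infixl 6 _-[_,_]

  _-[_,_] : Graph n → Fin n → Fin n → Graph n
  G -[ u , v ] = record
    { V      = V G
    ; Adj    = λ x y → Adj G x y × ¬ Same x y
    ; Adj⇒∈V = Adj⇒∈V G ∘ proj₁
    ; symm   = λ (xy , ¬s) → symm G xy , ¬s ∘ swapSame
    ; irrefl = λ x≡y → irrefl G x≡y ∘ proj₁
    ; _adj?_ = λ x y → _adj?_ G x y ×-dec ¬? ((x Fin.≟ u ×-dec y Fin.≟ v) ⊎-dec (x Fin.≟ v ×-dec y Fin.≟ u))
    }
    where
    Same : Rel (Fin n) 0ℓ
    Same x y = (x ≡ u × y ≡ v) ⊎ (x ≡ v × y ≡ u)
    swapSame : ∀ {x y} → Same y x → Same x y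
    swapSame (inj₁ (p , q)) = inj₂ (q , p)
    swapSame (inj₂ (p , q)) = inj₁ (q , p)

  _∈N_[_] : Fin n → Graph n → Fin n → Set
  y ∈N G [ u ] = Adj G u y ⊎ y ≡ u

  -- Endpoints are not required to lie in V G; only walks between vertices matter.
  data Walk (G : Graph n) : Fin n → Fin n → ℕ → Set where
    []  : ∀ {u} → Walk G u u 0
    _∷_ : ∀ {u v w ℓ} → Adj G u v → Walk G v w ℓ → Walk G u w (suc ℓ)

  IsDistance : Graph n → Fin n → Fin n → ℕ∞ → Set
  IsDistance G u v [ ℓ ] = IsLeast (Walk G u v) ℓ
  IsDistance G u v ⊤⁺    = ∀ ℓ → ¬ Walk G u v ℓ

  walk? : ∀ G u v → U.Decidable (Walk G u v)
  walk? G u v zero    = map′ (λ { refl → [] }) (λ { [] → refl }) (u Fin.≟ v)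
  walk? G u v (suc ℓ) = map′ (λ (_ , a , w) → a ∷ w) (λ { (a ∷ w) → _ , a , w })
    (Fin.any? λ x → _adj?_ G u x ×-dec walk? G x v ℓ)

  module _ {G : Graph n} where

    _++ʷ_ : ∀ {u v w k ℓ} → Walk G u v k → Walk G v w ℓ → Walk G u w (k + ℓ)
    []      ++ʷ q = q
    (a ∷ p) ++ʷ q = a ∷ (p ++ʷ q)

    at : ∀ {u v ℓ} → Walk G u v ℓ → Fin (suc ℓ) → Fin n
    at {u = u} _ zero    = u
    at (_ ∷ p)   (suc i) = at p i

    takeʷ : ∀ {u v ℓ} (p : Walk G u v ℓ) i → Walk G u (at p i) (toℕ i)
    takeʷ p       zero    = []
    takeʷ (a ∷ p) (suc i) = a ∷ takeʷ p i

    dropʷ : ∀ {u v ℓ} (p : Walk G u v ℓ) i → Walk G (at p i) v (ℓ ∸ toℕ i)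
    dropʷ p       zero    = p
    dropʷ (_ ∷ p) (suc i) = dropʷ p i

    shorten : ∀ {u v ℓ} → Walk G u v ℓ → n ≤ ℓ → ∃ λ k → k < ℓ × Walk G u v k
    shorten {v = v} {ℓ} p n≤ℓ with Fin.pigeonhole (s≤s n≤ℓ) (at p)
    ... | i , j , i<j , eq = toℕ i + (ℓ ∸ toℕ j) ,
          subst (toℕ i + (ℓ ∸ toℕ j) <_) (ℕ.m+[n∸m]≡n (s≤s⁻¹ (Fin.toℕ<n j)))
            (ℕ.+-monoˡ-< (ℓ ∸ toℕ j) i<j) ,
          (takeʷ p i ++ʷ subst (λ x → Walk G x v (ℓ ∸ toℕ j)) (sym eq) (dropʷ p j))

    short-walk : ∀ {u v} ℓ → Walk G u v ℓ → ∃ λ k → k < n × Walk G u v k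
    short-walk {u} {v} = <-rec (λ ℓ → Walk G u v ℓ → ∃ λ k → k < n × Walk G u v k) step
      where
      step : ∀ ℓ → (∀ {k} → k < ℓ → Walk G u v k → ∃ λ k → k < n × Walk G u v k) →
             Walk G u v ℓ → ∃ λ k → k < n × Walk G u v k
      step ℓ rec p with n ≤? ℓ
      ... | no n≰ℓ = ℓ , ℕ.≰⇒> n≰ℓ , p
      ... | yes n≤ℓ with shorten p n≤ℓ
      ...   | _ , k<ℓ , q = rec k<ℓ q

  distance : ∀ G u v → ∃ (IsDistance G u v)
  distance G u v with Fin.any? {n} (λ i → walk? G u v (toℕ i))
  ... | yes (i , p) with least (walk? G u v) (toℕ i) p
  ...   | ℓ , isLeast = [ ℓ ] , isLeast
  distance G u v | no ∄p = ⊤⁺ , λ ℓ p → let (k , k<n , q) = short-walk ℓ p in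
    ∄p (fromℕ< k<n , subst (Walk G u v) (sym (Fin.toℕ-fromℕ< k<n)) q)

  d : Graph n → Fin n → Fin n → ℕ∞
  d G u v = proj₁ (distance G u v)

  HasDiameter : Graph n → ℕ → Set
  HasDiameter G D =
    (∀ u v → u ∈ V G → v ∈ V G → d G u v ≤∞ [ D ]) ×
    (∃₂ λ u v → u ∈ V G × v ∈ V G × d G u v ≡ [ D ])

  Independent : Graph n → Subset n → Set
  Independent G A = A ⊆ V G × (∀ u v → u ∈ A → v ∈ A → ¬ Adj G u v)

  independent? : ∀ G → U.Decidable (Independent G)
  independent? G A = (A ⊆? V G) ×-dec
    (Fin.all? λ u → Fin.all? λ v → (u ∈? A) →-dec (v ∈? A) →-dec ¬? (_adj?_ G u v))

  IsIndependenceNumber : Graph n → ℕ → Set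
  IsIndependenceNumber G = IsGreatest λ k → ∃ λ A → Independent G A × ∣ A ∣ ≡ k

  independenceNumber : ∀ G → ∃ (IsIndependenceNumber G)
  independenceNumber G = greatest
    (λ k → anySubset? λ A → independent? G A ×-dec (∣ A ∣ ℕ.≟ k))
    (⊥ , (⊥⊆ , λ _ _ u∈⊥ → contradiction u∈⊥ ∉⊥) , ∣⊥∣≡0 n)
    n
    λ { _ (A , _ , refl) → ∣p∣≤n A }

  α : Graph n → ℕ
  α G = proj₁ (independenceNumber G)

  MaximumIndependent : Graph n → Subset n → Set
  MaximumIndependent G A = Independent G A × ∣ A ∣ ≡ α G

  -- Colorings are total on Fin n; values outside V G are unconstrained.
  IsPackingColoring : Graph n → ℕ → (Fin n → ℕ) → Set
  IsPackingColoring G k c =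
    (∀ v → v ∈ V G → 1 ≤ c v × c v ≤ k) ×
    (∀ u v → u ∈ V G → v ∈ V G → u ≢ v → c u ≡ c v → [ c u ] <∞ d G u v)

  PackingColorable : Graph n → ℕ → Set
  PackingColorable G k = ∃ (IsPackingColoring G k)

  isPackingColoring? : ∀ G k → U.Decidable (IsPackingColoring G k)
  isPackingColoring? G k c =
    (Fin.all? λ v → (v ∈? V G) →-dec (1 ≤? c v) ×-dec (c v ≤? k)) ×-dec
    (Fin.all? λ u → Fin.all? λ v → (u ∈? V G) →-dec (v ∈? V G) →-dec ¬? (u Fin.≟ v) →-dec
      (c u ℕ.≟ c v) →-dec <∞-dec ℕ._<?_ [ c u ] (d G u v))

  recolor : ∀ G k {c c′ : Fin n → ℕ} → (∀ v → v ∈ V G → c v ≡ c′ v) →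
            IsPackingColoring G k c → IsPackingColoring G k c′
  recolor G k eq (range , far) =
    (λ v v∈ → subst (λ x → 1 ≤ x × x ≤ k) (eq v v∈) (range v v∈)) ,
    (λ u v u∈ v∈ u≢v c′≡ → subst (λ x → [ x ] <∞ d G u v) (eq u u∈)
      (far u v u∈ v∈ u≢v (trans (eq u u∈) (trans c′≡ (sym (eq v v∈))))))

  anyVec? : ∀ {k m} {P : Vec (Fin k) m → Set} → U.Decidable P → Dec (∃ P)
  anyVec? {m = zero}  P? = map′ ([] ,_) (λ { ([] , p) → p }) (P? [])
  anyVec? {m = suc m} P? = map′ (λ (x , xs , p) → x ∷ xs , p) (λ { (x ∷ xs , p) → x , xs , p })
    (Fin.any? λ x → anyVec? λ xs → P? (x ∷ xs))

  packingColorable? : ∀ G → U.Decidable (PackingColorable G)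
  packingColorable? G k = map′
    (λ (xs , isC) → toℕ ∘ lookup xs , isC)
    (λ (c , isC) → tabulate (clip c) , recolor G k (clip-eq c (proj₁ isC)) isC)
    (anyVec? {suc k} {n} λ xs → isPackingColoring? G k (toℕ ∘ lookup xs))
    where
    clip : (Fin n → ℕ) → Fin n → Fin (suc k)
    clip c v with c v ≤? k
    ... | yes cv≤k = fromℕ< (s≤s cv≤k)
    ... | no  _    = zero
    toℕ-clip : ∀ c v → c v ≤ k → c v ≡ toℕ (clip c v)
    toℕ-clip c v cv≤k with c v ≤? k
    ... | yes p = sym (Fin.toℕ-fromℕ< (s≤s p))
    ... | no ¬p = contradiction cv≤k ¬p
    clip-eq : ∀ c → (∀ v → v ∈ V G → 1 ≤ c v × c v ≤ k) →
              ∀ v → v ∈ V G → c v ≡ toℕ (lookup (tabulate (clip c)) v)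
    clip-eq c range v v∈ = trans (toℕ-clip c v (proj₂ (range v v∈)))
      (cong toℕ (sym (lookup∘tabulate (clip c) v)))

  IsPackingChromaticNumber : Graph n → ℕ → Set
  IsPackingChromaticNumber G = IsLeast (PackingColorable G)

  packingChromaticNumber : ∀ G → ∃ (IsPackingChromaticNumber G)
  packingChromaticNumber G = least (packingColorable? G) n
    ( suc ∘ toℕ
    , (λ v _ → s≤s z≤n , Fin.toℕ<n v)
    , (λ u v _ _ u≢v eq → contradiction (Fin.toℕ-injective (ℕ.suc-injective eq)) u≢v))

  χρ : Graph n → ℕ
  χρ G = proj₁ (packingChromaticNumber G)

  Critical : Graph n → Set₁
  Critical G = ∀ H → ProperSubgraph H G → χρ H < χρ G

{-# OPTIONS --safe #-}

-- In a graph G of diameter 2 two vertices can only share colour 1, hence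
-- χρ G = |V| - α G + 1, and criticality amounts to χρ (G - e) ≤ |V| - α G for
-- every edge e.  If α (G - e) > α G this is immediate; if (ii) holds, colour A
-- with 1, both y and uⱼ with 2, and the remaining vertices injectively.
-- Conversely, take a colouring of G - e with at most |V| - α G colours.  When
-- α (G - e) ≤ α G, some colour ≥ 2 is repeated.  Two vertices at distance ≤ 2
-- in G but ≥ 3 in G - e are of the form y, uⱼ with y ∈ N[uᵢ], and only one such
-- pair can be monochromatic: if there were two, each would be at distance at
-- most 3 in G - e, but one of the two colours is at least 3.  So the class of
-- colour 1 has α G vertices, and it avoids y and uⱼ.

module Submission where

open import Defs
open import Data.Bool using (true)
open import Data.Nat using (ℕ; zero; suc; _+_; _≤_; _<_; z≤n; s≤s; s≤s⁻¹)
import Data.Nat.Properties as ℕ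
open import Data.Fin using (Fin; zero; suc; toℕ; fromℕ<)
import Data.Fin.Properties as Fin
open import Data.Fin.Subset using (Subset; Empty; _∩_; _∪_; ⁅_⁆; _∈_; _∉_; _⊆_; _─_; _-_; ∣_∣; ⊤; inside; outside)
open import Data.Fin.Subset.Properties using (_∈?_; x∈p∩q⁺; x∈p∩q⁻; x∈p∪q⁺; x∈p∪q⁻; x∈⁅x⁆; x∈⁅y⁆⇒x≡y; ∣⁅x⁆∣≡1; ∣⊤∣≡n; ∈⊤; drop-∷-⊆; p─q⊆p; x∈p∧x∉q⇒x∈p─q; x∈p∧x≢y⇒x∈p-y; x∈p⇒∣p-x∣<∣p∣)
open import Data.Empty using (⊥-elim)
open import Data.Product using (∃; ∃₂; _×_; _,_; proj₁; proj₂)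
open import Data.Sum using (_⊎_; inj₁; inj₂; [_,_]′)
open import Data.Vec using ([]; _∷_; here; there; tabulate)
open import Data.Vec.Properties using (lookup∘tabulate; []=⇒lookup; lookup⇒[]=)
open import Function using (_∘_)
open import Function.Bundles using (_⇔_; mk⇔)
open import Level using (0ℓ)
open import Relation.Binary using (REL)
open import Relation.Binary.PropositionalEquality using (_≡_; _≢_; refl; sym; trans; cong; subst; ≢-sym)
import Relation.Binary.Construct.Add.Supremum.Strict as Strict
import Relation.Binary.Construct.Add.Supremum.NonStrict as NonStrict
open import Relation.Nullary using (¬_; Dec; yes; no; does; contradiction)
open import Relation.Nullary.Construct.Add.Supremum using (⊤⁺; [_])
open import Relation.Nullary.Decidable using (_×-dec_; ¬?; dec-true; decidable-stable)

open Strict _<_ using ([_]; [_]<⊤⁺)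
open NonStrict _≤_ using ([_]; _≤⊤⁺)

-- Cardinalities of subsets

x∈p─q⇒x∉q : ∀ {n} (p q : Subset n) {x} → x ∈ p ─ q → x ∉ q
x∈p─q⇒x∉q (_ ∷ p) (_ ∷ q) (there x∈) (there x∈q) = x∈p─q⇒x∉q p q x∈ x∈q
x∈p─q⇒x∉q (_ ∷ p) (_ ∷ q) () here

∣p─q∣+∣q∣≡∣p∣ : ∀ {n} (p q : Subset n) → q ⊆ p → ∣ p ─ q ∣ + ∣ q ∣ ≡ ∣ p ∣
∣p─q∣+∣q∣≡∣p∣ []            []            q⊆p = refl
∣p─q∣+∣q∣≡∣p∣ (outside ∷ p) (outside ∷ q) q⊆p = ∣p─q∣+∣q∣≡∣p∣ p q (drop-∷-⊆ q⊆p)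
∣p─q∣+∣q∣≡∣p∣ (inside  ∷ p) (outside ∷ q) q⊆p = cong suc (∣p─q∣+∣q∣≡∣p∣ p q (drop-∷-⊆ q⊆p))
∣p─q∣+∣q∣≡∣p∣ (inside  ∷ p) (inside  ∷ q) q⊆p =
  trans (ℕ.+-suc _ _) (cong suc (∣p─q∣+∣q∣≡∣p∣ p q (drop-∷-⊆ q⊆p)))
∣p─q∣+∣q∣≡∣p∣ (outside ∷ p) (inside  ∷ q) q⊆p with () ← q⊆p here

-- The map is given as a relation so that it need only have values on members of `p`. Induction on
-- `p`: the image of the head is removed from `q`, and injectivity keeps the remaining images inside
-- the smaller set.
injective⇒∣p∣≤∣q∣ : ∀ {m n} (p : Subset m) (q : Subset n) (R : REL (Fin m) (Fin n) 0ℓ) →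
  (∀ {x} → x ∈ p → ∃ λ y → y ∈ q × R x y) →
  (∀ {x x′ y} → x ∈ p → x′ ∈ p → R x y → R x′ y → x ≡ x′) →
  ∣ p ∣ ≤ ∣ q ∣
injective⇒∣p∣≤∣q∣ []            q R total inj = z≤n
injective⇒∣p∣≤∣q∣ (outside ∷ p) q R total inj =
  injective⇒∣p∣≤∣q∣ p q (R ∘ suc) (total ∘ there)
    (λ x∈ x′∈ r r′ → Fin.suc-injective (inj (there x∈) (there x′∈) r r′))
injective⇒∣p∣≤∣q∣ (inside ∷ p) q R total inj with total here
... | y , y∈q , r = ℕ.≤-<-trans
  (injective⇒∣p∣≤∣q∣ p (q - y) (R ∘ suc)
    (λ x∈ → let (y′ , y′∈q , r′) = total (there x∈) in
      y′ , x∈p∧x≢y⇒x∈p-y y′∈q (λ { refl → Fin.0≢1+n (inj here (there x∈) r r′) }) , r′)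
    (λ x∈ x′∈ r r′ → Fin.suc-injective (inj (there x∈) (there x′∈) r r′)))
  (x∈p⇒∣p-x∣<∣p∣ y∈q)

-- The number of members of `p` below `x`; it numbers the members of `p` from 0 and later supplies
-- pairwise distinct colours.
rank : ∀ {n} → Subset n → Fin n → ℕ
rank (_       ∷ p) zero    = 0
rank (inside  ∷ p) (suc x) = suc (rank p x)
rank (outside ∷ p) (suc x) = rank p x

rank<∣p∣ : ∀ {n} (p : Subset n) {x} → x ∈ p → rank p x < ∣ p ∣
rank<∣p∣ (inside  ∷ p) here       = s≤s z≤n
rank<∣p∣ (inside  ∷ p) (there x∈) = s≤s (rank<∣p∣ p x∈)
rank<∣p∣ (outside ∷ p) (there x∈) = rank<∣p∣ p x∈

rank-injective : ∀ {n} (p : Subset n) {x y} → x ∈ p → y ∈ p → rank p x ≡ rank p y → x ≡ y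
rank-injective (inside  ∷ p) here       here       eq = refl
rank-injective (inside  ∷ p) (there x∈) (there y∈) eq =
  cong suc (rank-injective p x∈ y∈ (ℕ.suc-injective eq))
rank-injective (outside ∷ p) (there x∈) (there y∈) eq = cong suc (rank-injective p x∈ y∈ eq)

-- Distances and walks

module _ {n : ℕ} where

  -- Phrased by an explicit walk, so that its edges can be inspected one by one when an edge is
  -- deleted.
  Near : Graph n → Fin n → Fin n → Set
  Near G x z = ∃ λ ℓ → ℓ ≤ 2 × Walk G x z ℓ

  k<d⇒k<walk : ∀ (G : Graph n) {u v k ℓ} → [ k ] <∞ d G u v → Walk G u v ℓ → k < ℓ
  k<d⇒k<walk G {u} {v} k<d w with distance G u v | k<d
  ... | [ m ] , _ , min | [ k<m ] = ℕ.<-≤-trans k<m (min _ w)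
  ... | ⊤⁺    , none    | _       = contradiction w (none _)

  k<walk⇒k<d : ∀ (G : Graph n) {u v k} → (∀ ℓ → Walk G u v ℓ → k < ℓ) → [ k ] <∞ d G u v
  k<walk⇒k<d G {u} {v} {k} k<walk with distance G u v
  ... | [ m ] , w , _ = [ k<walk m w ]
  ... | ⊤⁺    , none  = [ k ]<⊤⁺

  1+k≤d⇒k<d : ∀ {k x} → [ suc k ] ≤∞ x → [ k ] <∞ x
  1+k≤d⇒k<d [ k<x ]      = [ k<x ]
  1+k≤d⇒k<d ([ _ ] ≤⊤⁺) = [ _ ]<⊤⁺

  j≤k<d⇒1+j≤d : ∀ {j k x} → j ≤ k → [ k ] <∞ x → [ suc j ] ≤∞ x
  j≤k<d⇒1+j≤d j≤k [ k<x ]   = [ ℕ.≤-<-trans j≤k k<x ]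
  j≤k<d⇒1+j≤d j≤k [ _ ]<⊤⁺ = _ ≤⊤⁺

  d≤2⇒Near : ∀ (G : Graph n) {u v} → d G u v ≤∞ [ 2 ] → Near G u v
  d≤2⇒Near G {u} {v} d≤2 with distance G u v | d≤2
  ... | [ ℓ ] , w , _ | [ ℓ≤2 ] = ℓ , ℓ≤2 , w

  mapʷ : ∀ {G H : Graph n} → H ⊑ G → ∀ {u v ℓ} → Walk H u v ℓ → Walk G u v ℓ
  mapʷ H⊑G []      = []
  mapʷ H⊑G (a ∷ w) = proj₂ H⊑G a ∷ mapʷ H⊑G w

  reverseʷ : ∀ {G : Graph n} {u v ℓ} → Walk G u v ℓ → Walk G v u ℓ
  reverseʷ []                      = []
  reverseʷ {G} {u} (_∷_ {ℓ = ℓ} a w) =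
    subst (Walk G _ _) (ℕ.+-comm ℓ 1) (reverseʷ w ++ʷ (symm G a ∷ []))

  -- Packing colourings and independent sets

  χρ-attained : ∀ (G : Graph n) → PackingColorable G (χρ G)
  χρ-attained G = proj₁ (proj₂ (packingChromaticNumber G))

  χρ-minimal : ∀ (G : Graph n) {k} → PackingColorable G k → χρ G ≤ k
  χρ-minimal G = proj₂ (proj₂ (packingChromaticNumber G)) _

  -- Walks of `H` are walks of `G`, so distances do not shrink in `H` and an optimal colouring of
  -- `G` still works there.
  χρ-mono-⊑ : ∀ {G H : Graph n} → H ⊑ G → χρ H ≤ χρ G
  χρ-mono-⊑ {G} {H} H⊑G with χρ-attained G
  ... | c , range , far = χρ-minimal H
    ( c
    , (λ v v∈ → range v (proj₁ H⊑G v∈))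
    , λ u v u∈ v∈ u≢v eq → k<walk⇒k<d H λ ℓ w →
        k<d⇒k<walk G (far u v (proj₁ H⊑G u∈) (proj₁ H⊑G v∈) u≢v eq) (mapʷ H⊑G w))

  Independent⇒∣A∣≤α : ∀ (G : Graph n) {A} → Independent G A → ∣ A ∣ ≤ α G
  Independent⇒∣A∣≤α G ind = proj₂ (proj₂ (independenceNumber G)) _ (_ , ind , refl)

  ∃MaximumIndependent : ∀ (G : Graph n) → ∃ (MaximumIndependent G)
  ∃MaximumIndependent G = proj₁ (proj₂ (independenceNumber G))

  Independent⇒1<d : ∀ (G : Graph n) {A u v} → Independent G A → u ∈ A → v ∈ A → u ≢ v →
                    [ 1 ] <∞ d G u v
  Independent⇒1<d G (_ , ind) u∈ v∈ u≢v = k<walk⇒k<d G λ where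
    _ []          → contradiction refl u≢v
    _ (a ∷ [])    → contradiction a (ind _ _ u∈ v∈)
    _ (_ ∷ _ ∷ _) → s≤s (s≤s z≤n)

  -- Each vertex of `R` receives a colour of its own among `k + 1`, ..., `k + ∣ R ∣`, so distances
  -- have to be checked only off `R`.
  extend : ∀ (G : Graph n) k (R : Subset n) (c : Fin n → ℕ) →
    (∀ v → v ∈ V G → v ∉ R → 1 ≤ c v × c v ≤ k) →
    (∀ u v → u ∈ V G → v ∈ V G → u ∉ R → v ∉ R → u ≢ v → c u ≡ c v → [ c u ] <∞ d G u v) →
    PackingColorable G (k + ∣ R ∣)
  extend G k R c range far = c′ , range′ , far′
    where
    c′ : Fin n → ℕ
    c′ v with v ∈? R
    ... | yes _ = suc (k + rank R v)
    ... | no  _ = c v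
    range′ : ∀ v → v ∈ V G → 1 ≤ c′ v × c′ v ≤ k + ∣ R ∣
    range′ v v∈ with v ∈? R
    ... | yes v∈R = s≤s z≤n , ℕ.+-monoʳ-< k (rank<∣p∣ R v∈R)
    ... | no  v∉R = let (1≤c , c≤k) = range v v∈ v∉R in 1≤c , ℕ.≤-trans c≤k (ℕ.m≤m+n k _)
    old≢new : ∀ {v i} → v ∈ V G → v ∉ R → c v ≢ suc (k + i)
    old≢new {v} v∈ v∉R eq = ℕ.<⇒≱ (s≤s (ℕ.m≤m+n k _)) (subst (_≤ k) eq (proj₂ (range v v∈ v∉R)))
    far′ : ∀ u v → u ∈ V G → v ∈ V G → u ≢ v → c′ u ≡ c′ v → [ c′ u ] <∞ d G u v
    far′ u v u∈ v∈ u≢v eq with u ∈? R | v ∈? R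
    ... | yes u∈R | yes v∈R = contradiction
            (rank-injective R u∈R v∈R (ℕ.+-cancelˡ-≡ k _ _ (ℕ.suc-injective eq))) u≢v
    ... | yes u∈R | no  v∉R = contradiction (sym eq) (old≢new v∈ v∉R)
    ... | no  u∉R | yes v∈R = contradiction eq (old≢new u∈ u∉R)
    ... | no  u∉R | no  v∉R = far u v u∈ v∈ u∉R v∉R u≢v eq

  x∈p∧x∉p─q⇒x∈q : ∀ {p q : Subset n} {x} → x ∈ p → x ∉ p ─ q → x ∈ q
  x∈p∧x∉p─q⇒x∈q {q = q} {x} x∈p x∉ = decidable-stable (x ∈? q) λ x∉q → x∉ (x∈p∧x∉q⇒x∈p─q x∈p x∉q)

  -- Colour a maximum independent set with 1 and all other vertices injectively. No diameter is
  -- assumed, so the bound also applies to `G - e`.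
  χρ+α≤1+∣V∣ : ∀ (G : Graph n) → χρ G + α G ≤ suc ∣ V G ∣
  χρ+α≤1+∣V∣ G with ∃MaximumIndependent G
  ... | A , ind , ∣A∣≡α = begin
    χρ G + α G                  ≤⟨ ℕ.+-monoˡ-≤ (α G) (χρ-minimal G colorable) ⟩
    suc (∣ V G ─ A ∣ + α G)      ≡⟨ cong (λ a → suc (∣ V G ─ A ∣ + a)) ∣A∣≡α ⟨
    suc (∣ V G ─ A ∣ + ∣ A ∣)    ≡⟨ cong suc (∣p─q∣+∣q∣≡∣p∣ (V G) A (proj₁ ind)) ⟩
    suc ∣ V G ∣                  ∎
    where
    open ℕ.≤-Reasoning
    colorable : PackingColorable G (1 + ∣ V G ─ A ∣)
    colorable = extend G 1 (V G ─ A) (λ _ → 1) (λ _ _ _ → s≤s z≤n , s≤s z≤n)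
      λ u v u∈ v∈ u∉ v∉ u≢v _ → Independent⇒1<d G ind (x∈p∧x∉p─q⇒x∈q u∈ u∉) (x∈p∧x∉p─q⇒x∈q v∈ v∉) u≢v

  -- One colour is saved by letting `y` and `z` share colour 2. The distance is bounded in both
  -- orders because the colouring condition ranges over ordered pairs.
  χρ+∣A∣≤∣V∣ : ∀ (G : Graph n) {A y z} → Independent G A → y ∈ V G → z ∈ V G → y ∉ A → z ∉ A →
               y ≢ z → [ 2 ] <∞ d G y z → [ 2 ] <∞ d G z y → χρ G + ∣ A ∣ ≤ ∣ V G ∣
  χρ+∣A∣≤∣V∣ G {A} {y} {z} ind y∈ z∈ y∉A z∉A y≢z far-yz far-zy = begin
    χρ G + ∣ A ∣       ≤⟨ ℕ.+-monoˡ-≤ ∣ A ∣ (χρ-minimal G (extend G 2 R c range far)) ⟩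
    2 + ∣ R ∣ + ∣ A ∣  ≤⟨ ℕ.+-monoˡ-≤ ∣ A ∣ 2+∣R∣≤∣B∣ ⟩
    ∣ B ∣ + ∣ A ∣      ≡⟨ ∣p─q∣+∣q∣≡∣p∣ (V G) A (proj₁ ind) ⟩
    ∣ V G ∣            ∎
    where
    open ℕ.≤-Reasoning
    B R : Subset n
    B = V G ─ A
    R = B - y - z
    2+∣R∣≤∣B∣ : 2 + ∣ R ∣ ≤ ∣ B ∣
    2+∣R∣≤∣B∣ = ℕ.≤-trans
      (s≤s (x∈p⇒∣p-x∣<∣p∣ (x∈p∧x≢y⇒x∈p-y (x∈p∧x∉q⇒x∈p─q z∈ z∉A) (≢-sym y≢z))))
      (x∈p⇒∣p-x∣<∣p∣ (x∈p∧x∉q⇒x∈p─q y∈ y∉A))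
    -- Among vertices of `G` outside `R`, only `y` and `z` get colour 2; on `R` the value is
    -- overwritten by `extend`.
    c : Fin n → ℕ
    c v with v ∈? A
    ... | yes _ = 1
    ... | no  _ = 2
    range : ∀ v → v ∈ V G → v ∉ R → 1 ≤ c v × c v ≤ 2
    range v _ _ with v ∈? A
    ... | yes _ = s≤s z≤n , s≤s z≤n
    ... | no  _ = s≤s z≤n , s≤s (s≤s z≤n)
    y-or-z : ∀ {v} → v ∈ V G → v ∉ A → v ∉ R → v ≡ y ⊎ v ≡ z
    y-or-z {v} v∈ v∉A v∉R with v Fin.≟ y | v Fin.≟ z
    ... | yes v≡y | _       = inj₁ v≡y
    ... | no _    | yes v≡z = inj₂ v≡z
    ... | no v≢y  | no v≢z  = contradiction
            (x∈p∧x≢y⇒x∈p-y (x∈p∧x≢y⇒x∈p-y (x∈p∧x∉q⇒x∈p─q v∈ v∉A) v≢y) v≢z) v∉R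
    far : ∀ u v → u ∈ V G → v ∈ V G → u ∉ R → v ∉ R → u ≢ v → c u ≡ c v → [ c u ] <∞ d G u v
    far u v u∈ v∈ u∉R v∉R u≢v eq with u ∈? A | v ∈? A
    ... | yes u∈A | yes v∈A = Independent⇒1<d G ind u∈A v∈A u≢v
    ... | yes _   | no  _   with () ← eq
    far u v u∈ v∈ u∉R v∉R u≢v eq | no _ | yes _ with () ← eq
    far u v u∈ v∈ u∉R v∉R u≢v eq | no u∉A | no v∉A with y-or-z u∈ u∉A u∉R | y-or-z v∈ v∉A v∉R
    ... | inj₁ refl | inj₁ refl = contradiction refl u≢v
    ... | inj₁ refl | inj₂ refl = far-yz
    ... | inj₂ refl | inj₁ refl = far-zy
    ... | inj₂ refl | inj₂ refl = contradiction refl u≢v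

  -- The intersection with `V G` matters: a colouring may take the value 1 anywhere outside it.
  ones : Graph n → (Fin n → ℕ) → Subset n
  ones G c = V G ∩ tabulate λ v → does (c v ℕ.≟ 1)

  ∈ones⁺ : ∀ (G : Graph n) c {v} → v ∈ V G → c v ≡ 1 → v ∈ ones G c
  ∈ones⁺ G c {v} v∈ cv≡1 = x∈p∩q⁺
    (v∈ , lookup⇒[]= v _ (trans (lookup∘tabulate _ v) (dec-true (c v ℕ.≟ 1) cv≡1)))

  ∈ones⁻ : ∀ (G : Graph n) c {v} → v ∈ ones G c → c v ≡ 1
  ∈ones⁻ G c {v} v∈ = witness (c v ℕ.≟ 1)
    (trans (sym (lookup∘tabulate _ v)) ([]=⇒lookup (proj₂ (x∈p∩q⁻ (V G) _ v∈))))
    where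
    witness : ∀ {P : Set} (P? : Dec P) → does P? ≡ true → P
    witness (yes p) _ = p

  ones⊆V : ∀ (G : Graph n) c → ones G c ⊆ V G
  ones⊆V G c = proj₁ ∘ x∈p∩q⁻ (V G) _

  module _ (G : Graph n) {k c} (isC : IsPackingColoring G k c) where

    ones-independent : Independent G (ones G c)
    ones-independent = ones⊆V G c , λ u v u∈ v∈ a →
      let cu≡1 = ∈ones⁻ G c u∈
          far  = proj₂ isC u v (ones⊆V G c u∈) (ones⊆V G c v∈) (λ u≡v → irrefl G u≡v a)
                   (trans cu≡1 (sym (∈ones⁻ G c v∈)))
      in ℕ.<-irrefl cu≡1 (k<d⇒k<walk G far (a ∷ []))

    ∉ones⇒2≤c : ∀ {v} → v ∈ V G ─ ones G c → v ∈ V G × 2 ≤ c v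
    ∉ones⇒2≤c {v} v∈B = v∈ , ℕ.≤∧≢⇒< (proj₁ (proj₁ isC v v∈))
      λ 1≡cv → x∈p─q⇒x∉q (V G) _ v∈B (∈ones⁺ G c v∈ (sym 1≡cv))
      where v∈ = p─q⊆p (V G) _ v∈B

    ∣V─ones∣+∣ones∣≡∣V∣ : ∣ V G ─ ones G c ∣ + ∣ ones G c ∣ ≡ ∣ V G ∣
    ∣V─ones∣+∣ones∣≡∣V∣ = ∣p─q∣+∣q∣≡∣p∣ (V G) (ones G c) (ones⊆V G c)

    -- The members of `S` use distinct colours from 2, ..., `k`, of which there are `k - 1`. The
    -- vertex `v₀` guarantees `1 ≤ k`, so the strict bound survives an empty `S`.
    injective⇒∣S∣<k : ∀ {v₀} (S : Subset n) → v₀ ∈ V G → S ⊆ V G ─ ones G c →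
      (∀ {x z} → x ∈ S → z ∈ S → c x ≡ c z → x ≡ z) → ∣ S ∣ < k
    injective⇒∣S∣<k S v₀∈ S⊆ inj with ℕ.≤-trans (proj₁ (proj₁ isC _ v₀∈)) (proj₂ (proj₁ isC _ v₀∈))
    ... | s≤s {n = k′} _ = s≤s (subst (∣ S ∣ ≤_) (∣⊤∣≡n k′)
      (injective⇒∣p∣≤∣q∣ S ⊤ (λ v i → c v ≡ 2 + toℕ i) total
        λ x∈ x′∈ r r′ → inj x∈ x′∈ (trans r (sym r′))))
      where
      total : ∀ {x} → x ∈ S → ∃ λ i → i ∈ ⊤ {k′} × c x ≡ 2 + toℕ i
      total {x} x∈ with c x | ∉ones⇒2≤c (S⊆ x∈) | proj₁ isC x (proj₁ (∉ones⇒2≤c (S⊆ x∈)))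
      ... | suc (suc i) | _ , s≤s (s≤s z≤n) | _ , s≤s i<k′ =
        fromℕ< i<k′ , ∈⊤ , cong (2 +_) (sym (Fin.toℕ-fromℕ< i<k′))

  -- Graphs in which any two vertices are at distance at most 2

  module _ (G : Graph n) (near : ∀ {u v} → u ∈ V G → v ∈ V G → Near G u v) where

    -- In an optimal colouring no colour above 1 repeats, since distances are at most 2; the class
    -- of colour 1 has at most `α G` members. With `χρ+α≤1+∣V∣` this determines `χρ G`.
    1+∣V∣≤χρ+α : ∀ {v₀} → v₀ ∈ V G → suc ∣ V G ∣ ≤ χρ G + α G
    1+∣V∣≤χρ+α v₀∈ with χρ-attained G
    ... | c , isC = begin
      suc ∣ V G ∣                              ≡⟨ cong suc (∣V─ones∣+∣ones∣≡∣V∣ G isC) ⟨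
      suc ∣ V G ─ ones G c ∣ + ∣ ones G c ∣    ≤⟨ ℕ.+-mono-≤ ∣B∣<χρ (Independent⇒∣A∣≤α G (ones-independent G isC)) ⟩
      χρ G + α G                               ∎
      where
      open ℕ.≤-Reasoning
      ∣B∣<χρ : ∣ V G ─ ones G c ∣ < χρ G
      ∣B∣<χρ = injective⇒∣S∣<k G isC (V G ─ ones G c) v₀∈ (λ x∈ → x∈) λ {x} {z} x∈ z∈ eq →
        decidable-stable (x Fin.≟ z) λ x≢z →
          let (x∈V , 2≤cx)  = ∉ones⇒2≤c G isC x∈
              (z∈V , _)     = ∉ones⇒2≤c G isC z∈
              (_ , ℓ≤2 , w) = near x∈V z∈V
          in ℕ.<⇒≱ (k<d⇒k<walk G (proj₂ isC x z x∈V z∈V x≢z eq) w) (ℕ.≤-trans ℓ≤2 2≤cx)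

    -- Deleting an edge

    module _ (u₁ u₂ : Fin n) where

      private
        H : Graph n
        H = G -[ u₁ , u₂ ]

      Ends : Fin n → Fin n → Set
      Ends x y = (x ≡ u₁ × y ≡ u₂) ⊎ (x ≡ u₂ × y ≡ u₁)

      Ends-sym : ∀ {x y} → Ends x y → Ends y x
      Ends-sym (inj₁ (p , q)) = inj₂ (q , p)
      Ends-sym (inj₂ (p , q)) = inj₁ (q , p)

      Ends-unique : ∀ {p q x y} → Ends p q → Ends x y → (x ≡ p × y ≡ q) ⊎ (x ≡ q × y ≡ p)
      Ends-unique (inj₁ (refl , refl)) e = e
      Ends-unique (inj₂ (refl , refl)) (inj₁ e) = inj₂ e
      Ends-unique (inj₂ (refl , refl)) (inj₂ e) = inj₁ e

      kept-or-deleted : ∀ {x y} → Adj G x y → Adj H x y ⊎ Ends x y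
      kept-or-deleted {x} {y} a with x Fin.≟ u₁ | y Fin.≟ u₂ | x Fin.≟ u₂ | y Fin.≟ u₁
      ... | yes p | yes q | _     | _     = inj₂ (inj₁ (p , q))
      ... | _     | _     | yes p | yes q = inj₂ (inj₂ (p , q))
      ... | no ¬p | _     | no ¬r | _     = inj₁ (a , [ ¬p ∘ proj₁ , ¬r ∘ proj₁ ]′)
      ... | no ¬p | _     | yes _ | no ¬s = inj₁ (a , [ ¬p ∘ proj₁ , ¬s ∘ proj₂ ]′)
      ... | yes _ | no ¬q | no ¬r | _     = inj₁ (a , [ ¬q ∘ proj₂ , ¬r ∘ proj₁ ]′)
      ... | yes _ | no ¬q | yes _ | no ¬s = inj₁ (a , [ ¬q ∘ proj₂ , ¬s ∘ proj₂ ]′)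

      -- The shape of the pair `y`, `uⱼ` in (ii), in either order; the distance in `H` is not part
      -- of it.
      Separated : Fin n → Fin n → Set
      Separated x z = ∃₂ λ p q → Ends p q × ((z ≡ q × x ∈N G [ p ]) ⊎ (x ≡ q × z ∈N G [ p ]))

      -- A walk of length at most 2 in `G` either survives in `H` or uses the deleted edge. In the
      -- latter case one end of the walk is an endpoint of that edge, and its other end is the other
      -- endpoint or adjacent to it.
      near-or-separated : ∀ {x z} → x ∈ V G → z ∈ V G → Near H x z ⊎ Separated x z
      near-or-separated x∈ z∈ with near x∈ z∈
      ... | _ , _ , []       = inj₁ (_ , z≤n , [])
      ... | _ , _ , a ∷ []   with kept-or-deleted a
      ...   | inj₁ a′ = inj₁ (_ , s≤s z≤n , a′ ∷ [])
      ...   | inj₂ e  = inj₂ (_ , _ , e , inj₁ (refl , inj₂ refl))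
      near-or-separated x∈ z∈ | _ , _ , a ∷ b ∷ [] with kept-or-deleted a | kept-or-deleted b
      ...   | inj₁ a′ | inj₁ b′ = inj₁ (_ , s≤s (s≤s z≤n) , a′ ∷ b′ ∷ [])
      ...   | inj₂ e  | _       = inj₂ (_ , _ , Ends-sym e , inj₂ (refl , inj₁ b))
      ...   | inj₁ _  | inj₂ e  = inj₂ (_ , _ , e , inj₁ (refl , inj₁ (symm G a)))
      near-or-separated x∈ z∈ | _ , s≤s (s≤s ()) , _ ∷ _ ∷ _ ∷ _

      -- Repeated colours after the deletion

      module _ {k c} (isC : IsPackingColoring H k c) where

        private
          c<walk : ∀ {x z ℓ} → x ∈ V G → z ∈ V G → x ≢ z → c x ≡ c z → Walk H x z ℓ → c x < ℓ
          c<walk x∈ z∈ x≢z eq w = k<d⇒k<walk H (proj₂ isC _ _ x∈ z∈ x≢z eq) w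

          adjacent⇒c≢ : ∀ {x z} → 2 ≤ c x → Adj H x z → c x ≢ c z
          adjacent⇒c≢ 2≤c a eq = let (x∈ , z∈) = Adj⇒∈V H a in
            ℕ.<⇒≱ (c<walk x∈ z∈ (λ x≡z → irrefl H x≡z a) eq (a ∷ [])) (ℕ.<⇒≤ 2≤c)

        repeated⇒Separated : ∀ {x z} → x ∈ V G → z ∈ V G → x ≢ z → 2 ≤ c x → c x ≡ c z →
                             Separated x z
        repeated⇒Separated x∈ z∈ x≢z 2≤c eq with near-or-separated x∈ z∈
        ... | inj₂ s             = s
        ... | inj₁ (_ , ℓ≤2 , w) = contradiction (ℕ.≤-trans ℓ≤2 2≤c) (ℕ.<⇒≱ (c<walk x∈ z∈ x≢z eq w))

        module _ {p q y} (ends : Ends p q) (y∈N : y ∈N G [ p ]) (p∈ : p ∈ V G) (q∈ : q ∈ V G)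
                 (y∈ : y ∈ V G) (y≢q : y ≢ q) (2≤cq : 2 ≤ c q) (cy≡cq : c y ≡ c q) where

          -- The edge `qz` survives. If `y` is `p`, then the adjacent vertices `q` and `z` share a
          -- colour. Otherwise `py` survives too, and `y`, `z` are near in `H` because neither is an
          -- endpoint of the deleted edge. The walks `p`, `y`, ..., `z` and `y`, ..., `z`, `q` then
          -- have length at most 3, which forces both colours to be 2, although `p` and `y` are
          -- adjacent.
          no-second-pair : ∀ {z} → z ∈ V G → z ∈N G [ q ] → z ≢ p → z ≢ q → 2 ≤ c z → c p ≢ c z
          no-second-pair {z} z∈ z∈N z≢p z≢q 2≤cz cp≡cz = absurd y∈N
            where
            qz : Adj H q z
            qz = [ [ (λ a → a) , (λ e → contradiction (Ends-unique ends e) [ z≢q ∘ proj₂ , z≢p ∘ proj₂ ]′) ]′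
                     ∘ kept-or-deleted
                 , (λ z≡q → contradiction z≡q z≢q) ]′ z∈N
            2≤cp : 2 ≤ c p
            2≤cp = subst (2 ≤_) (sym cp≡cz) 2≤cz
            2≤cy : 2 ≤ c y
            2≤cy = subst (2 ≤_) (sym cy≡cq) 2≤cq
            far-apart : Adj H p y → ¬ Near H y z
            far-apart py (ℓ , ℓ≤2 , w) = adjacent⇒c≢ 2≤cp py (trans cp≡2 (sym cy≡2))
              where
              cp≡2 : c p ≡ 2
              cp≡2 = ℕ.≤-antisym
                (ℕ.≤-trans (s≤s⁻¹ (c<walk p∈ z∈ (≢-sym z≢p) cp≡cz (py ∷ w))) ℓ≤2) 2≤cp
              cy≡2 : c y ≡ 2
              cy≡2 = ℕ.≤-antisym
                (s≤s⁻¹ (ℕ.≤-trans (c<walk y∈ q∈ y≢q cy≡cq (w ++ʷ (symm H qz ∷ []))) (ℕ.+-monoˡ-≤ 1 ℓ≤2)))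
                2≤cy
            not-separated : y ≢ p → ¬ Separated y z
            not-separated y≢p (p′ , q′ , e , s) with Ends-unique ends e
            ... | inj₁ (_ , refl) = [ z≢q ∘ proj₁ , y≢q ∘ proj₁ ]′ s
            ... | inj₂ (_ , refl) = [ z≢p ∘ proj₁ , y≢p ∘ proj₁ ]′ s
            absurd : ¬ (y ∈N G [ p ])
            absurd (inj₂ y≡p) = adjacent⇒c≢ 2≤cq qz (trans (sym cy≡cq) (trans (cong c y≡p) cp≡cz))
            absurd (inj₁ py) with kept-or-deleted py
            ... | inj₂ e   = [ y≢q ∘ proj₂ , (λ (_ , y≡p) → irrefl G (sym y≡p) py) ]′ (Ends-unique ends e)
            ... | inj₁ py′ = [ far-apart py′ , not-separated (λ y≡p → irrefl G (sym y≡p) py) ]′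
                               (near-or-separated y∈ z∈)

          -- A repeated colour comes from a separated pair. Since `q` is excluded, the pair consists
          -- of `p` and a vertex of `N[q]`, that is, a second pair.
          injective-off-q : ∀ {x z} → x ∈ V G → z ∈ V G → x ≢ q → z ≢ q → 2 ≤ c x → c x ≡ c z → x ≡ z
          injective-off-q {x} {z} x∈ z∈ x≢q z≢q 2≤cx eq = decidable-stable (x Fin.≟ z) λ x≢z →
            let (_ , _ , e , s) = repeated⇒Separated x∈ z∈ x≢z 2≤cx eq in
            impossible x≢z (Ends-unique ends e) s
            where
            impossible : ∀ {p′ q′} → x ≢ z → (p′ ≡ p × q′ ≡ q) ⊎ (p′ ≡ q × q′ ≡ p) →
                         ¬ ((z ≡ q′ × x ∈N G [ p′ ]) ⊎ (x ≡ q′ × z ∈N G [ p′ ]))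
            impossible x≢z (inj₁ (_ , refl)) = [ z≢q ∘ proj₁ , x≢q ∘ proj₁ ]′
            impossible x≢z (inj₂ (refl , refl)) (inj₁ (refl , x∈N)) =
              no-second-pair x∈ x∈N x≢z x≢q 2≤cx (sym eq)
            impossible x≢z (inj₂ (refl , refl)) (inj₂ (refl , z∈N)) =
              no-second-pair z∈ z∈N (≢-sym x≢z) z≢q (subst (2 ≤_) eq 2≤cx) eq

          ones-maximum : k + α G ≤ ∣ V G ∣ → MaximumIndependent G (ones H c)
          ones-maximum k+α≤∣V∣ = indG , ℕ.≤-antisym (Independent⇒∣A∣≤α G indG) α≤∣A∣
            where
            A B : Subset n
            A = ones H c
            B = V G ─ A
            q∉A : q ∉ A
            q∉A q∈A = ℕ.<⇒≱ 2≤cq (ℕ.≤-reflexive (∈ones⁻ H c q∈A))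
            q∈B : q ∈ B
            q∈B = x∈p∧x∉q⇒x∈p─q q∈ q∉A
            avoid : ∀ u v → u ∈ A → v ∈ A → (u ≡ p × v ≡ q) ⊎ (u ≡ q × v ≡ p) → q ∈ A
            avoid u v u∈ v∈ (inj₁ (_ , refl)) = v∈
            avoid u v u∈ v∈ (inj₂ (refl , _)) = u∈
            -- The deleted edge cannot lie inside `A`, because its endpoint `q` has colour at least
            -- 2.
            indG : Independent G A
            indG = ones⊆V H c , λ u v u∈ v∈ a →
              [ proj₂ (ones-independent H isC) u v u∈ v∈
              , (λ e → q∉A (avoid u v u∈ v∈ (Ends-unique ends e))) ]′ (kept-or-deleted a)
            -- Without `q` the colours on `B` are distinct, so `B` has at most `k` members. Then
            -- `k + α G ≤ ∣ V G ∣` leaves at least `α G` vertices for `A`.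
            ∣B-q∣<k : ∣ B - q ∣ < k
            ∣B-q∣<k = injective⇒∣S∣<k H isC (B - q) q∈ (p─q⊆p B ⁅ q ⁆) λ x∈ z∈ eq →
              let (x∈V , 2≤cx) = ∉ones⇒2≤c H isC (p─q⊆p B ⁅ q ⁆ x∈)
                  (z∈V , _)    = ∉ones⇒2≤c H isC (p─q⊆p B ⁅ q ⁆ z∈)
              in injective-off-q x∈V z∈V (≢q x∈) (≢q z∈) 2≤cx eq
              where
              ≢q : ∀ {x} → x ∈ B - q → x ≢ q
              ≢q x∈ refl = x∈p─q⇒x∉q B ⁅ q ⁆ x∈ (x∈⁅x⁆ q)
            ∣B∣≤k : ∣ B ∣ ≤ k
            ∣B∣≤k = begin
              ∣ B ∣                  ≡⟨ ∣p─q∣+∣q∣≡∣p∣ B ⁅ q ⁆ (λ x∈ → subst (_∈ B) (sym (x∈⁅y⁆⇒x≡y q x∈)) q∈B) ⟨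
              ∣ B - q ∣ + ∣ ⁅ q ⁆ ∣  ≡⟨ cong (∣ B - q ∣ +_) (∣⁅x⁆∣≡1 q) ⟩
              ∣ B - q ∣ + 1          ≡⟨ ℕ.+-comm _ 1 ⟩
              suc ∣ B - q ∣          ≤⟨ ∣B-q∣<k ⟩
              k                      ∎
              where open ℕ.≤-Reasoning
            α≤∣A∣ : α G ≤ ∣ A ∣
            α≤∣A∣ = ℕ.+-cancelˡ-≤ k _ _ (begin
              k + α G        ≤⟨ k+α≤∣V∣ ⟩
              ∣ V G ∣        ≡⟨ ∣V─ones∣+∣ones∣≡∣V∣ H isC ⟨
              ∣ B ∣ + ∣ A ∣  ≤⟨ ℕ.+-monoˡ-≤ ∣ A ∣ ∣B∣≤k ⟩
              k + ∣ A ∣      ∎)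
              where open ℕ.≤-Reasoning

      -- Condition (ii) with `p`, `q` for `uᵢ`, `uⱼ`, written so that it unfolds to the very type in
      -- the theorem.
      FarPairAvoided : Set
      FarPairAvoided = ∃₂ λ p q → Ends p q × (∃ λ y → y ∈N G [ p ] × [ 3 ] ≤∞ d H y q ×
        (∃ λ A → MaximumIndependent G A × Empty (A ∩ (⁅ y ⁆ ∪ ⁅ q ⁆))))

      Ends⇒∈V : Adj G u₁ u₂ → ∀ {p q} → Ends p q → p ∈ V G × q ∈ V G
      Ends⇒∈V e (inj₁ (refl , refl)) = Adj⇒∈V G e
      Ends⇒∈V e (inj₂ (refl , refl)) = Adj⇒∈V G (symm G e)

      χρ[G-e]<χρ⇒FarPairAvoided : Adj G u₁ u₂ → α H ≤ α G → χρ H < χρ G → FarPairAvoided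
      χρ[G-e]<χρ⇒FarPairAvoided e αH≤αG χH<χG with χρ-attained H
      ... | c , isC = go (Fin.any? λ x → Fin.any? λ z →
              (x ∈? B) ×-dec (z ∈? B) ×-dec ¬? (x Fin.≟ z) ×-dec (c x ℕ.≟ c z))
        where
        k : ℕ
        k = χρ H
        B : Subset n
        B = V G ─ ones H c
        k+α≤∣V∣ : k + α G ≤ ∣ V G ∣
        k+α≤∣V∣ = s≤s⁻¹ (ℕ.≤-trans (ℕ.+-monoˡ-≤ (α G) χH<χG) (χρ+α≤1+∣V∣ G))
        -- Class 1 has at most `α H ≤ α G` members, so at least `k` vertices share the `k - 1`
        -- colours above 1 and some colour repeats.
        k≤∣B∣ : k ≤ ∣ B ∣
        k≤∣B∣ = ℕ.+-cancelʳ-≤ (α G) _ _ (begin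
          k + α G                 ≤⟨ k+α≤∣V∣ ⟩
          ∣ V G ∣                 ≡⟨ ∣V─ones∣+∣ones∣≡∣V∣ H isC ⟨
          ∣ B ∣ + ∣ ones H c ∣    ≤⟨ ℕ.+-monoʳ-≤ ∣ B ∣ (ℕ.≤-trans (Independent⇒∣A∣≤α H (ones-independent H isC)) αH≤αG) ⟩
          ∣ B ∣ + α G             ∎)
          where open ℕ.≤-Reasoning
        build : ∀ {p q y} → Ends p q → y ∈N G [ p ] → y ∈ B → q ∈ B → y ≢ q → c y ≡ c q → FarPairAvoided
        build {p} {q} {y} ends y∈N y∈B q∈B y≢q eq =
          p , q , ends , y , y∈N , j≤k<d⇒1+j≤d 2≤cy (proj₂ isC y q y∈ q∈ y≢q eq) , ones H c ,
          ones-maximum isC ends y∈N (proj₁ (Ends⇒∈V e ends)) q∈ y∈ y≢q (subst (2 ≤_) eq 2≤cy) eq k+α≤∣V∣ ,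
          λ (x , x∈) → let (x∈A , x∈yq) = x∈p∩q⁻ (ones H c) _ x∈ in
            [ (λ x∈y → x∈p─q⇒x∉q (V G) _ y∈B (subst (_∈ ones H c) (x∈⁅y⁆⇒x≡y y x∈y) x∈A))
            , (λ x∈q → x∈p─q⇒x∉q (V G) _ q∈B (subst (_∈ ones H c) (x∈⁅y⁆⇒x≡y q x∈q) x∈A))
            ]′ (x∈p∪q⁻ ⁅ y ⁆ ⁅ q ⁆ x∈yq)
          where
          y∈   = proj₁ (∉ones⇒2≤c H isC y∈B)
          2≤cy = proj₂ (∉ones⇒2≤c H isC y∈B)
          q∈   = proj₁ (∉ones⇒2≤c H isC q∈B)
        go : Dec (∃₂ λ x z → x ∈ B × z ∈ B × x ≢ z × c x ≡ c z) → FarPairAvoided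
        go (no none) = contradiction k≤∣B∣ (ℕ.<⇒≱
          (injective⇒∣S∣<k H isC B (proj₁ (Adj⇒∈V G e)) (λ x∈ → x∈) λ {x} {z} x∈ z∈ eq →
            decidable-stable (x Fin.≟ z) λ x≢z → none (x , z , x∈ , z∈ , x≢z , eq)))
        go (yes (x , z , x∈ , z∈ , x≢z , eq)) with
          repeated⇒Separated isC (proj₁ (∉ones⇒2≤c H isC x∈)) (proj₁ (∉ones⇒2≤c H isC z∈)) x≢z
            (proj₂ (∉ones⇒2≤c H isC x∈)) eq
        ... | _ , _ , ends , inj₁ (refl , x∈N) = build ends x∈N x∈ z∈ x≢z eq
        ... | _ , _ , ends , inj₂ (refl , z∈N) = build ends z∈N z∈ x∈ (≢-sym x≢z) (sym eq)

      -- The upper bound is applied to `H` and the lower bound to `G`; both graphs have the same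
      -- vertex set.
      α<α[G-e]⇒χρ[G-e]<χρ : Adj G u₁ u₂ → α G < α H → χρ H < χρ G
      α<α[G-e]⇒χρ[G-e]<χρ e α<α = ℕ.+-cancelʳ-< (α G) _ _ (begin-strict
        χρ H + α G     <⟨ ℕ.+-monoʳ-< (χρ H) α<α ⟩
        χρ H + α H     ≤⟨ χρ+α≤1+∣V∣ H ⟩
        suc ∣ V G ∣    ≤⟨ 1+∣V∣≤χρ+α (proj₁ (Adj⇒∈V G e)) ⟩
        χρ G + α G     ∎)
        where open ℕ.≤-Reasoning

      FarPairAvoided⇒χρ[G-e]<χρ : Adj G u₁ u₂ → FarPairAvoided → χρ H < χρ G
      FarPairAvoided⇒χρ[G-e]<χρ e (p , q , ends , y , y∈N , 3≤d , A , ((A⊆V , ind) , ∣A∣≡α) , empty) =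
        ℕ.+-cancelʳ-< (α G) _ _ (begin-strict
          χρ H + α G      ≡⟨ cong (χρ H +_) ∣A∣≡α ⟨
          χρ H + ∣ A ∣    ≤⟨ χρ+∣A∣≤∣V∣ H indH y∈ q∈ y∉A q∉A y≢q 2<d (k<walk⇒k<d H λ _ → 2<walk ∘ reverseʷ) ⟩
          ∣ V G ∣         <⟨ 1+∣V∣≤χρ+α (proj₁ (Adj⇒∈V G e)) ⟩
          χρ G + α G      ∎)
        where
        open ℕ.≤-Reasoning
        indH : Independent H A
        indH = A⊆V , λ u v u∈ v∈ → ind u v u∈ v∈ ∘ proj₁
        p∈ = proj₁ (Ends⇒∈V e ends)
        q∈ = proj₂ (Ends⇒∈V e ends)
        y∈ : y ∈ V G
        y∈ = [ proj₂ ∘ Adj⇒∈V G , (λ y≡p → subst (_∈ V G) (sym y≡p) p∈) ]′ y∈N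
        y∉A : y ∉ A
        y∉A y∈A = empty (y , x∈p∩q⁺ (y∈A , x∈p∪q⁺ (inj₁ (x∈⁅x⁆ y))))
        q∉A : q ∉ A
        q∉A q∈A = empty (q , x∈p∩q⁺ (q∈A , x∈p∪q⁺ (inj₂ (x∈⁅x⁆ q))))
        2<d = 1+k≤d⇒k<d 3≤d
        2<walk : ∀ {ℓ} → Walk H y q ℓ → 2 < ℓ
        2<walk = k<d⇒k<walk H 2<d
        -- Otherwise the empty walk would join `y` to `q`.
        y≢q : y ≢ q
        y≢q refl with () ← 2<walk []

-- From proper subgraphs to edge deletions

edge-missing : ∀ {n} {G H : Graph n} → (∀ {v} → v ∈ V G → ∃ (Adj G v)) → ¬ (G ⊑ H) →
               ∃₂ λ u v → Adj G u v × ¬ Adj H u v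
edge-missing {G = G} {H} incident G⋢H
  with Fin.any? (λ u → Fin.any? λ v → _adj?_ G u v ×-dec ¬? (_adj?_ H u v))
... | yes missing = missing
-- Every vertex of `G` lies on an edge, so an `H` that keeps all edges keeps all vertices as well.
... | no ¬missing = ⊥-elim (G⋢H ((λ v∈ → proj₁ (Adj⇒∈V H (kept (proj₂ (incident v∈))))) , kept))
  where
  kept : ∀ {u v} → Adj G u v → Adj H u v
  kept {u} {v} a = decidable-stable (_adj?_ H u v) λ ¬a → ¬missing (u , v , a , ¬a)

⊑-delete : ∀ {n} {G H : Graph n} {u v} → H ⊑ G → ¬ Adj H u v → H ⊑ (G -[ u , v ])
⊑-delete {H = H} (V⊆ , Adj⊆) ¬uv = V⊆ , λ a → Adj⊆ a , λ where
  (inj₁ (refl , refl)) → ¬uv a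
  (inj₂ (refl , refl)) → ¬uv (symm H a)

delete-proper : ∀ {n} (G : Graph n) {u v} → Adj G u v → ProperSubgraph (G -[ u , v ]) G
delete-proper G uv = ((λ v∈ → v∈) , proj₁) , λ (_ , Adj⊆) → proj₂ (Adj⊆ uv) (inj₁ (refl , refl))

diameter2⇒Near : ∀ {n} {G : Graph n} → HasDiameter G 2 → ∀ {u v} → u ∈ V G → v ∈ V G → Near G u v
diameter2⇒Near {G = G} (d≤2 , _) u∈ v∈ = d≤2⇒Near G (d≤2 _ _ u∈ v∈)

diameter2⇒incident : ∀ {n} {G : Graph n} → HasDiameter G 2 → ∀ {v} → v ∈ V G → ∃ (Adj G v)
diameter2⇒incident {G = G} diam@(_ , a , b , a∈ , b∈ , d≡2) {v} v∈ with v Fin.≟ a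
... | no  v≢a  = first-edge v≢a (diameter2⇒Near {G = G} diam v∈ a∈)
  where
  first-edge : ∀ {x} → v ≢ x → Near G v x → ∃ (Adj G v)
  first-edge v≢x (_ , _ , [])    = contradiction refl v≢x
  first-edge v≢x (_ , _ , e ∷ _) = _ , e
... | yes refl with diameter2⇒Near {G = G} diam v∈ b∈
...   | _ , _ , e ∷ _ = _ , e
-- An empty walk would identify `a` and `b`, which are at distance 2.
...   | _ , _ , []    with () ← k<d⇒k<walk G (subst ([ 0 ] <∞_) (sym d≡2) [ s≤s z≤n ]) []

theorem4p1 : ∀ {n : ℕ} (G : Graph n) → HasDiameter G 2 →
    Critical G ⇔
    (∀ (u₁ u₂ : Fin n) → Adj G u₁ u₂ →
    (α G < α (G -[ u₁ , u₂ ]))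
    ⊎
    (∃₂ λ (uᵢ uⱼ : Fin n) → ((uᵢ ≡ u₁ × uⱼ ≡ u₂) ⊎ (uᵢ ≡ u₂ × uⱼ ≡ u₁)) ×
    (∃ λ (y : Fin n) → y ∈N G [ uᵢ ] × [ 3 ] ≤∞ d (G -[ u₁ , u₂ ]) y uⱼ ×
    (∃ λ (A : Subset n) → MaximumIndependent G A × Empty (A ∩ (⁅ y ⁆ ∪ ⁅ uⱼ ⁆))))))
theorem4p1 G diam = mk⇔ critical⇒ critical⇐
  where
  near = λ {u v} → diameter2⇒Near {G = G} diam {u} {v}
  critical⇒ : Critical G → ∀ u₁ u₂ → Adj G u₁ u₂ →
              α G < α (G -[ u₁ , u₂ ]) ⊎ FarPairAvoided G near u₁ u₂
  critical⇒ critical u₁ u₂ e with α G ℕ.<? α (G -[ u₁ , u₂ ])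
  ... | yes α<α = inj₁ α<α
  ... | no  α≮α = inj₂ (χρ[G-e]<χρ⇒FarPairAvoided G near u₁ u₂ e (ℕ.≮⇒≥ α≮α)
                          (critical (G -[ u₁ , u₂ ]) (delete-proper G e)))
  critical⇐ : (∀ u₁ u₂ → Adj G u₁ u₂ → α G < α (G -[ u₁ , u₂ ]) ⊎ FarPairAvoided G near u₁ u₂) →
              Critical G
  critical⇐ cond H (H⊑G , G⋢H)
    with u , v , uv , ¬uv ← edge-missing {G = G} {H} (diameter2⇒incident {G = G} diam) G⋢H =
    -- `H` lies inside `G - uv` for a missing edge `uv`, so by monotonicity it suffices that `χρ`
    -- drops on deleting `uv`.
    ℕ.≤-<-trans (χρ-mono-⊑ {G = G -[ u , v ]} {H} (⊑-delete {G = G} {H} H⊑G ¬uv))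
      ([ α<α[G-e]⇒χρ[G-e]<χρ G near u v uv , FarPairAvoided⇒χρ[G-e]<χρ G near u v uv ]′ (cond u v uv))
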